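{- Let $\mathbb T$ be a theory. Write $\Gamma\sqsubseteq\Delta$ if the context $\Gamma$ is a subsequence of the context $\Delta$, and $\Theta\sqsubseteq\Xi$ if the metavariable context $\Theta$ is a subsequence of the metavariable context $\Xi$. Then: (1) if $\Gamma\sqsubseteq\Delta$, $\Theta;\Gamma\vdash\mathcal J$ and $\Theta;\Delta\vdash$, then $\Theta;\Delta\vdash\mathcal J$; (2) if $\Theta\sqsubseteq\Xi$, $\Theta;\Gamma\vdash\mathcal J$ and $\Xi\vdash$, then $\Xi;\Gamma\vdash\mathcal J$. Here $\Theta;\Gamma\vdash\mathcal J$ stands for any one of the judgments $\Theta;\Gamma\vdash$, $\Theta;\Gamma\vdash T\ \mathsf{sort}$, $\Theta;\Gamma\vdash t:T$, $\Theta;\Gamma\vdash\vec t:\Delta'$, $\Theta;\Gamma\vdash\mathbf t:\Xi'$.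
   Context: **Syntax.** Expressions are taken up to renaming of bound variables (equivalently, de Bruijn indices) and implicitly weakened to larger scopes; concatenated scopes are regarded as disjoint. A scope $\gamma$ is a finite list of variables; a metavariable scope $\theta$ is a finite list of entries $\mathtt x\{\delta\}$ with $\delta$ a scope; a signature $\Sigma$ is a finite list of entries $o(\theta)$, where each operation $o$ is either a constructor (written $c$) or a destructor (written $d$). Concatenation is written with a dot, $\cdot$ is the empty list. For fixed $\Sigma$, by mutual induction: terms $\mathsf{Tm}\,\theta\,\gamma$ are $x$ ($x\in\gamma$), $\mathtt x\{\vec t\}$ ($\mathtt x\{\delta\}\in\theta$, $\vec t\in\mathsf{Sub}\,\theta\,\gamma\,\delta$), $o(\mathbf t)$ ($o(\xi)\in\Sigma$, $\mathbf t\in\mathsf{MSub}\,\theta\,\gamma\,\xi$); substitutions $\mathsf{Sub}\,\theta\,\gamma\,\delta$ are lists of terms in $\mathsf{Tm}\,\theta\,\gamma$, one $t_x$ for each $x\in\delta$; metavariable substitutions $\mathsf{MSub}\,\theta\,\gamma\,\xi$ are lists with one entry $\vec x_\delta.t$, $t\in\mathsf{Tm}\,\theta\,(\gamma.\delta)$ (variables of $\delta$ bound), for each $\mathtt x\{\delta\}\in\xi$, and $\mathbf t_{\mathtt x}$ denotes this $t$; $\varepsilon$ is the empty list. $\mathsf{Ctx}\,\theta\,\gamma$: lists $x_1:T_1,\dots,x_k:T_k$ with $T_i\in\mathsf{Tm}\,\theta\,(\gamma,x_1,\dots,x_{i-1})$; underlying scope $|\Gamma|=x_1,\dots,x_k$.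 $\mathsf{MCtx}\,\theta$: lists $\mathtt x_1\{\Gamma_1\}:T_1,\dots,\mathtt x_k\{\Gamma_k\}:T_k$ with $\Gamma_i\in\mathsf{Ctx}\,(\theta.\xi_i)\,(\cdot)$ and $T_i\in\mathsf{Tm}\,(\theta.\xi_i)\,|\Gamma_i|$, where $\xi_i=\mathtt x_1\{|\Gamma_1|\},\dots,\mathtt x_{i-1}\{|\Gamma_{i-1}|\}$; $|\Theta|=\mathtt x_1\{|\Gamma_1|\},\dots,\mathtt x_k\{|\Gamma_k|\}$. Abbreviate $\mathsf{Ctx}\,\theta=\mathsf{Ctx}\,\theta\,(\cdot)$, $\mathsf{Ctx}=\mathsf{Ctx}\,(\cdot)\,(\cdot)$, $\mathsf{MCtx}=\mathsf{MCtx}\,(\cdot)$. $\mathsf{id}_\gamma$ is the list of variables of $\gamma$. For $\vec v\in\mathsf{Sub}\,\theta\,\gamma_1\,\gamma_2$ and $e$ over $\theta,\gamma_2$, $e[\vec v]$ (over $\theta,\gamma_1$) is capture-avoiding simultaneous substitution. For $\mathbf v\in\mathsf{MSub}\,\theta_1\,\delta\,\theta_2$ and $e$ over $\theta_2,\gamma$, $e[\mathbf v]$ (over $\theta_1,\delta.\gamma$) is defined structurally by $x[\mathbf v]=x$, $\mathtt x\{\vec t\}[\mathbf v]=\mathbf v_{\mathtt x}[\mathsf{id}_\delta,\vec t[\mathbf v]]$, $o(\mathbf t)[\mathbf v]=o(\mathbf t[\mathbf v])$, componentwise on lists and contexts. **Patterns and theories.** $\mathsf{Tm}^{\mathsf P}\,\theta\,\gamma$: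 $\mathtt x\{\mathsf{id}_\gamma\}$ if $\theta$ is exactly $\mathtt x\{\gamma\}$; or $c(\mathbf t)$ with $c(\xi)\in\Sigma$ a constructor and $\mathbf t\in\mathsf{MSub}^{\mathsf P}\,\theta\,\gamma\,\xi$. $\mathsf{MSub}^{\mathsf P}\,\theta\,\gamma\,\xi$: $\varepsilon$ if $\xi=\theta=\cdot$; or $\mathbf t,\vec x_\delta.t$ if $\xi=\xi',\mathtt x\{\delta\}$, $\theta=\theta_1.\theta_2$, $\mathbf t\in\mathsf{MSub}^{\mathsf P}\,\theta_1\,\gamma\,\xi'$, $t\in\mathsf{Tm}^{\mathsf P}\,\theta_2\,(\gamma.\delta)$. A theory $\mathbb T$, with underlying signature $|\mathbb T|$, is built from the empty theory by successively adding entries over the current signature (declared symbols pairwise distinct): sort rules $c(\Xi)\ \mathsf{sort}$ with $\Xi\in\mathsf{MCtx}$ (adds $c(|\Xi|)$ to the signature); constructor rules $c(\Xi_p;\Xi_c;\mathbf v_i/\Xi_i):T$ with $\Xi_p\in\mathsf{MCtx}$, $\Xi_c,\Xi_i\in\mathsf{MCtx}\,|\Xi_p|$, $\mathbf v_i\in\mathsf{MSub}\,|\Xi_p.\Xi_c|\,(\cdot)\,|\Xi_i|$, $T\in\mathsf{Tm}^{\mathsf P}\,|\Xi_p.\Xi_i|\,(\cdot)$ (adds $c(|\Xi_c|)$); destructor rules $d(\Xi_{pi};\mathtt x:T;\Xi_d):U$ with $\Xi_{pi}\in\mathsf{MCtx}$, $T\in\mathsf{Tm}^{\mathsf P}\,|\Xi_{pi}|\,(\cdot)$,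 $\Xi_d\in\mathsf{MCtx}\,|\Xi_{pi},\mathtt x:T|$, $U\in\mathsf{Tm}\,|\Xi_{pi}.(\mathtt x:T).\Xi_d|\,(\cdot)$ (adds $d(\mathtt x,|\Xi_d|)$); rewrite rules $\theta\Vdash d(\mathbf t)\longmapsto r$ with $d(\xi)\in|\mathbb T|$, $\mathbf t\in\mathsf{MSub}^{\mathsf P}\,\theta\,(\cdot)\,\xi$, $r\in\mathsf{Tm}\,\theta\,(\cdot)$, such that $\mathbf t[\mathbf u]\ne\mathbf t'[\mathbf u']$ for every earlier rule $\theta'\Vdash d(\mathbf t')\longmapsto r'$ and all $\mathbf u,\mathbf u'$. The relation $\longrightarrow$ is the closure under all expression formers (one component at a time, also under binders and in contexts) of $d(\mathbf u[\mathbf t])\longrightarrow r[\mathbf t]$ for $(\theta_0\Vdash d(\mathbf u)\longmapsto r)\in\mathbb T$, $\mathbf t\in\mathsf{MSub}\,\theta\,\gamma\,\theta_0$; $\equiv$ is its reflexive-symmetric-transitive closure. **Declarative typing** (inductively defined; $\Theta\in\mathsf{MCtx}$, $\Gamma,\Delta\in\mathsf{Ctx}\,|\Theta|$, $\Xi\in\mathsf{MCtx}$). $\cdot\vdash$; $\Theta,\mathtt x\{\Gamma\}:T\vdash$ if $\Theta;\Gamma\vdash T\ \mathsf{sort}$. $\Theta;\cdot\vdash$ if $\Theta\vdash$; $\Theta;\Gamma,x:T\vdash$ if $\Theta;\Gamma\vdash T\ \mathsf{sort}$. Sort: $\Theta;\Gamma\vdash c(\mathbf t)\ \mathsf{sort}$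 if $c(\Xi)\ \mathsf{sort}\in\mathbb T$ and $\Theta;\Gamma\vdash\mathbf t:\Xi$. Var: $\Theta;\Gamma\vdash x:T$ if $x:T\in\Gamma$ and $\Theta;\Gamma\vdash$. MVar: $\Theta;\Gamma\vdash\mathtt x\{\vec t\}:T[\vec t]$ if $\mathtt x\{\Delta\}:T\in\Theta$ and $\Theta;\Gamma\vdash\vec t:\Delta$. Cons: $\Theta;\Gamma\vdash c(\mathbf t):T[\mathbf t_p,\mathbf v_i[\mathbf t_p,\mathbf t]]$ if $c(\Xi_p;\Xi_c;\mathbf v_i/\Xi_i):T\in\mathbb T$, $\Theta;\Gamma\vdash\mathbf t_p,\mathbf t:\Xi_p.\Xi_c$ and $\Theta;\Gamma\vdash T[\mathbf t_p,\mathbf v_i[\mathbf t_p,\mathbf t]]\ \mathsf{sort}$. Dest: $\Theta;\Gamma\vdash d(\mathbf t):U[\mathbf t_{pi},\mathbf t]$ if $d(\Xi_{pi};\mathtt x:T;\Xi_d):U\in\mathbb T$ and $\Theta;\Gamma\vdash\mathbf t_{pi},\mathbf t:\Xi_{pi}.(\mathtt x:T).\Xi_d$. Conv: $\Theta;\Gamma\vdash t:U$ if $\Theta;\Gamma\vdash t:T$, $T\equiv U$, $\Theta;\Gamma\vdash U\ \mathsf{sort}$. Substitutions: $\Theta;\Gamma\vdash\varepsilon:(\cdot)$ if $\Theta;\Gamma\vdash$; $\Theta;\Gamma\vdash\vec t,t:(\Delta,x:T)$ if $\Theta;\Gamma\vdash\vec t:\Delta$ and $\Theta;\Gamma\vdash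 t:T[\vec t]$. Metavariable substitutions: $\Theta;\Gamma\vdash\varepsilon:(\cdot)$ if $\Theta;\Gamma\vdash$; $\Theta;\Gamma\vdash\mathbf t,\vec x_\Delta.t:(\Xi,\mathtt x\{\Delta\}:T)$ if $\Theta;\Gamma\vdash\mathbf t:\Xi$ and $\Theta;\Gamma.\Delta[\mathbf t]\vdash t:T[\mathbf t]$. -}

module Defs where

open import Data.Fin using (Fin; zero; suc; _↑ˡ_; _↑ʳ_)
open import Data.List using (List; []; _∷_; _++_; map)
open import Data.List.Membership.Propositional using (_∈_)
open import Data.List.Membership.Propositional.Properties using (∈-++⁺ˡ; ∈-++⁺ʳ)
open import Data.List.Relation.Unary.Any using (here; there)
open import Data.Nat using (ℕ; zero; suc; _+_)
open import Data.Product using (_×_; _,_)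
open import Function using (id; _∘_)
open import Relation.Binary.Construct.Closure.Equivalence using (EqClosure)
open import Relation.Binary.PropositionalEquality using (_≡_; _≢_; refl)

infixl 5 _▸_ _▹_⦂_ _⧺ˢ_ _⧺_ _⧺ᶜ_ _⧺ᴹ_
infix  4 _∶_ _∶ˢ_ _∶ᴹ_
infix  3 _⊑_ _⊑ᴹ_ _⊢_⟶_ _⊢_⟶ˢ_ _⊢_⟶ᴹ_ _⊢_≈_ _∣_⊢ _∣_⨟_⊢_

-- Everything is in de Bruijn form.  Scopes, metavariable scopes and signatures
-- are kept with the most recently added entry first, so the concatenation γ.δ
-- of scopes is  δ + γ , and θ.ξ of metavariable scopes is  ξ ++ θ .

Scope : Set
Scope = ℕ

MScope : Set
MScope = List Scope

data Kind : Set where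
  con des : Kind

Sig : Set
Sig = List (Kind × MScope)

variable
  Σ : Sig
  θ θ′ θ₁ θ₂ ξ ξ₁ ξ₂ : MScope
  γ γ′ γ₁ γ₂ γ₃ δ δ₁ δ₂ : Scope
  k : Kind

data Tm   (Σ : Sig) (θ : MScope) (γ : Scope) : Set
data Sub  (Σ : Sig) (θ : MScope) (γ : Scope) : Scope → Set
data MSub (Σ : Sig) (θ : MScope) (γ : Scope) : MScope → Set

data Tm Σ θ γ where
  var  : Fin γ → Tm Σ θ γ
  mvar : δ ∈ θ → Sub Σ θ γ δ → Tm Σ θ γ
  op   : (k , ξ) ∈ Σ → MSub Σ θ γ ξ → Tm Σ θ γ

data Sub Σ θ γ where
  ε   : Sub Σ θ γ 0
  _▸_ : Sub Σ θ γ δ → Tm Σ θ γ → Sub Σ θ γ (suc δ)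

data MSub Σ θ γ where
  ε   : MSub Σ θ γ []
  _▸_ : MSub Σ θ γ ξ → Tm Σ θ (δ + γ) → MSub Σ θ γ (δ ∷ ξ)

-- Contexts are indexed by the whole scope they end in, not only by their own
-- variables: Ctx Σ θ γ γ′ consists of the Γ ∈ Ctx θ γ with γ.|Γ| = γ′.
-- Likewise MCtx Σ θ θ′ consists of the Ξ ∈ MCtx θ with θ.|Ξ| = θ′; in
-- particular Ξ : MCtx Σ θ (ξ ++ θ) says that |Ξ| = ξ.

data Ctx (Σ : Sig) (θ : MScope) (γ : Scope) : Scope → Set where
  []  : Ctx Σ θ γ γ
  _▸_ : Ctx Σ θ γ γ′ → Tm Σ θ γ′ → Ctx Σ θ γ (suc γ′)

data MCtx (Σ : Sig) (θ : MScope) : MScope → Set where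
  []    : MCtx Σ θ θ
  _▹_⦂_ : MCtx Σ θ θ′ → Ctx Σ θ′ 0 δ → Tm Σ θ′ δ → MCtx Σ θ (δ ∷ θ′)

_⧺ˢ_ : Sub Σ θ γ δ₁ → Sub Σ θ γ δ₂ → Sub Σ θ γ (δ₂ + δ₁)
σ ⧺ˢ ε       = σ
σ ⧺ˢ (τ ▸ t) = (σ ⧺ˢ τ) ▸ t

_⧺_ : MSub Σ θ γ ξ₁ → MSub Σ θ γ ξ₂ → MSub Σ θ γ (ξ₂ ++ ξ₁)
u ⧺ ε       = u
u ⧺ (v ▸ t) = (u ⧺ v) ▸ t

_⧺ᶜ_ : Ctx Σ θ γ₁ γ₂ → Ctx Σ θ γ₂ γ₃ → Ctx Σ θ γ₁ γ₃
Γ ⧺ᶜ []      = Γ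
Γ ⧺ᶜ (Δ ▸ T) = (Γ ⧺ᶜ Δ) ▸ T

_⧺ᴹ_ : MCtx Σ θ θ₁ → MCtx Σ θ₁ θ₂ → MCtx Σ θ θ₂
Θ ⧺ᴹ []          = Θ
Θ ⧺ᴹ (Ξ ▹ Γ ⦂ T) = (Θ ⧺ᴹ Ξ) ▹ Γ ⦂ T

Ren : Scope → Scope → Set
Ren γ γ′ = Fin γ → Fin γ′

lift : ∀ δ → Ren γ γ′ → Ren (δ + γ) (δ + γ′)
lift zero    ρ x       = ρ x
lift (suc δ) ρ zero    = zero
lift (suc δ) ρ (suc x) = suc (lift δ ρ x)

renTm   : Ren γ γ′ → Tm Σ θ γ → Tm Σ θ γ′
renSub  : Ren γ γ′ → Sub Σ θ γ δ → Sub Σ θ γ′ δ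
renMSub : Ren γ γ′ → MSub Σ θ γ ξ → MSub Σ θ γ′ ξ

renTm ρ (var x)    = var (ρ x)
renTm ρ (mvar x σ) = mvar x (renSub ρ σ)
renTm ρ (op o t)   = op o (renMSub ρ t)

renSub ρ ε       = ε
renSub ρ (σ ▸ t) = renSub ρ σ ▸ renTm ρ t

renMSub ρ ε                 = ε
renMSub ρ (_▸_ {δ = δ} u t) = renMSub ρ u ▸ renTm (lift δ ρ) t

MRen : MScope → MScope → Set
MRen θ θ′ = ∀ {δ} → δ ∈ θ → δ ∈ θ′

mrenTm   : MRen θ θ′ → Tm Σ θ γ → Tm Σ θ′ γ
mrenSub  : MRen θ θ′ → Sub Σ θ γ δ → Sub Σ θ′ γ δ
mrenMSub : MRen θ θ′ → MSub Σ θ γ ξ → MSub Σ θ′ γ ξ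

mrenTm μ (var x)    = var x
mrenTm μ (mvar x σ) = mvar (μ x) (mrenSub μ σ)
mrenTm μ (op o t)   = op o (mrenMSub μ t)

mrenSub μ ε       = ε
mrenSub μ (σ ▸ t) = mrenSub μ σ ▸ mrenTm μ t

mrenMSub μ ε       = ε
mrenMSub μ (u ▸ t) = mrenMSub μ u ▸ mrenTm μ t

mrenCtx : MRen θ θ′ → Ctx Σ θ γ γ′ → Ctx Σ θ′ γ γ′
mrenCtx μ []      = []
mrenCtx μ (Γ ▸ T) = mrenCtx μ Γ ▸ mrenTm μ T

wkTm   : ∀ {e} → Tm Σ θ γ → Tm (e ∷ Σ) θ γ
wkSub  : ∀ {e} → Sub Σ θ γ δ → Sub (e ∷ Σ) θ γ δ
wkMSub : ∀ {e} → MSub Σ θ γ ξ → MSub (e ∷ Σ) θ γ ξ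

wkTm (var x)    = var x
wkTm (mvar x σ) = mvar x (wkSub σ)
wkTm (op o t)   = op (there o) (wkMSub t)

wkSub ε       = ε
wkSub (σ ▸ t) = wkSub σ ▸ wkTm t

wkMSub ε       = ε
wkMSub (u ▸ t) = wkMSub u ▸ wkTm t

wkCtx : ∀ {e} → Ctx Σ θ γ γ′ → Ctx (e ∷ Σ) θ γ γ′
wkCtx []      = []
wkCtx (Γ ▸ T) = wkCtx Γ ▸ wkTm T

wkMCtx : ∀ {e} → MCtx Σ θ θ′ → MCtx (e ∷ Σ) θ θ′
wkMCtx []          = []
wkMCtx (Θ ▹ Γ ⦂ T) = wkMCtx Θ ▹ wkCtx Γ ⦂ wkTm T

vars : Ren δ γ → Sub Σ θ γ δ
vars {δ = zero}  ρ = ε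
vars {δ = suc δ} ρ = vars (ρ ∘ suc) ▸ var (ρ zero)

idSub : Sub Σ θ γ γ
idSub = vars id

lookupSub : Sub Σ θ γ δ → Fin δ → Tm Σ θ γ
lookupSub (σ ▸ t) zero    = t
lookupSub (σ ▸ t) (suc x) = lookupSub σ x

liftSub : ∀ δ → Sub Σ θ γ₁ γ₂ → Sub Σ θ (δ + γ₁) (δ + γ₂)
liftSub zero    σ = σ
liftSub (suc δ) σ = renSub suc (liftSub δ σ) ▸ var zero

subTm   : Sub Σ θ γ₁ γ₂ → Tm Σ θ γ₂ → Tm Σ θ γ₁
subSub  : Sub Σ θ γ₁ γ₂ → Sub Σ θ γ₂ δ → Sub Σ θ γ₁ δ
subMSub : Sub Σ θ γ₁ γ₂ → MSub Σ θ γ₂ ξ → MSub Σ θ γ₁ ξ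

subTm σ (var x)    = lookupSub σ x
subTm σ (mvar x τ) = mvar x (subSub σ τ)
subTm σ (op o t)   = op o (subMSub σ t)

subSub σ ε       = ε
subSub σ (τ ▸ t) = subSub σ τ ▸ subTm σ t

subMSub σ ε                 = ε
subMSub σ (_▸_ {δ = δ} u t) = subMSub σ u ▸ subTm (liftSub δ σ) t

lookupMSub : MSub Σ θ γ ξ → δ ∈ ξ → Tm Σ θ (δ + γ)
lookupMSub (v ▸ t) (here refl) = t
lookupMSub (v ▸ t) (there x)   = lookupMSub v x

-- The expression e over θ₂, γ is instantiated by v ∈ MSub θ₁ δ θ₂.  The result
-- scope δ.γ is given as any γ′ together with the inclusions w of δ and ρ of γ
-- in it; this avoids transporting along associativity of + under binders.

instTm   : MSub Σ θ₁ δ θ₂ → Ren δ γ′ → Ren γ γ′ → Tm Σ θ₂ γ → Tm Σ θ₁ γ′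
instSub  : MSub Σ θ₁ δ θ₂ → Ren δ γ′ → Ren γ γ′ → Sub Σ θ₂ γ δ₁ → Sub Σ θ₁ γ′ δ₁
instMSub : MSub Σ θ₁ δ θ₂ → Ren δ γ′ → Ren γ γ′ → MSub Σ θ₂ γ ξ → MSub Σ θ₁ γ′ ξ

instTm v w ρ (var x)    = var (ρ x)
instTm v w ρ (mvar x σ) = subTm (vars w ⧺ˢ instSub v w ρ σ) (lookupMSub v x)
instTm v w ρ (op o t)   = op o (instMSub v w ρ t)

instSub v w ρ ε       = ε
instSub v w ρ (σ ▸ t) = instSub v w ρ σ ▸ instTm v w ρ t

instMSub v w ρ ε                 = ε
instMSub v w ρ (_▸_ {δ = δ} u t) =
  instMSub v w ρ u ▸ instTm v ((δ ↑ʳ_) ∘ w) (lift δ ρ) t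

_[_] : Tm Σ θ₂ γ → MSub Σ θ₁ δ θ₂ → Tm Σ θ₁ (γ + δ)
_[_] {γ = γ} {δ = δ} t v = instTm v (γ ↑ʳ_) (_↑ˡ δ) t

_[_]ᴹ : MSub Σ θ₂ γ ξ → MSub Σ θ₁ δ θ₂ → MSub Σ θ₁ (γ + δ) ξ
_[_]ᴹ {γ = γ} {δ = δ} t v = instMSub v (γ ↑ʳ_) (_↑ˡ δ) t

_[_]ᶜ : Ctx Σ θ₂ γ γ′ → MSub Σ θ₁ δ θ₂ → Ctx Σ θ₁ (γ + δ) (γ′ + δ)
[]      [ v ]ᶜ = []
(Γ ▸ T) [ v ]ᶜ = (Γ [ v ]ᶜ) ▸ (T [ v ])

data TmP   (Σ : Sig) : MScope → Scope → Set
data MSubP (Σ : Sig) : MScope → Scope → MScope → Set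

data TmP Σ where
  mvar : TmP Σ (γ ∷ []) γ
  cons : (con , ξ) ∈ Σ → MSubP Σ θ γ ξ → TmP Σ θ γ

data MSubP Σ where
  ε   : MSubP Σ [] γ []
  _▸_ : MSubP Σ θ₁ γ ξ → TmP Σ θ₂ (δ + γ) → MSubP Σ (θ₂ ++ θ₁) γ (δ ∷ ξ)

⌜_⌝  : TmP Σ θ γ → Tm Σ θ γ
⌜_⌝ᴹ : MSubP Σ θ γ ξ → MSub Σ θ γ ξ

⌜ mvar ⌝     = mvar (here refl) idSub
⌜ cons c t ⌝ = op c ⌜ t ⌝ᴹ

⌜ ε ⌝ᴹ = ε
⌜ _▸_ {θ₂ = θ₂} u t ⌝ᴹ = mrenMSub (∈-++⁺ʳ θ₂) ⌜ u ⌝ᴹ ▸ mrenTm ∈-++⁺ˡ ⌜ t ⌝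

wkTmP   : ∀ {e} → TmP Σ θ γ → TmP (e ∷ Σ) θ γ
wkMSubP : ∀ {e} → MSubP Σ θ γ ξ → MSubP (e ∷ Σ) θ γ ξ

wkTmP mvar       = mvar
wkTmP (cons c t) = cons (there c) (wkMSubP t)

wkMSubP ε       = ε
wkMSubP (u ▸ t) = wkMSubP u ▸ wkTmP t

-- Rule Σ k ξ: the rules over Σ that declare a symbol of kind k and arity ξ.

data Rule (Σ : Sig) : Kind → MScope → Set where
  sortRule : MCtx Σ [] ξ → Rule Σ con ξ
  consRule : ∀ {θp ξc ξi}
             (Ξp : MCtx Σ [] θp)
             (Ξc : MCtx Σ θp (ξc ++ θp))
             (Ξi : MCtx Σ θp (ξi ++ θp))
             (vi : MSub Σ (ξc ++ θp) 0 ξi)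
             (T  : TmP Σ (ξi ++ θp) 0) →
             Rule Σ con ξc
  destRule : ∀ {θpi ξd}
             (Ξpi : MCtx Σ [] θpi)
             (T   : TmP Σ θpi 0)
             (Ξd  : MCtx Σ (0 ∷ θpi) (ξd ++ 0 ∷ θpi))
             (U   : Tm Σ (ξd ++ 0 ∷ θpi) 0) →
             Rule Σ des (ξd ++ 0 ∷ [])

wkRule : ∀ {e} → Rule Σ k ξ → Rule (e ∷ Σ) k ξ
wkRule (sortRule Ξ)             = sortRule (wkMCtx Ξ)
wkRule (consRule Ξp Ξc Ξi vi T) =
  consRule (wkMCtx Ξp) (wkMCtx Ξc) (wkMCtx Ξi) (wkMSub vi) (wkTmP T)
wkRule (destRule Ξpi T Ξd U)    =
  destRule (wkMCtx Ξpi) (wkTmP T) (wkMCtx Ξd) (wkTm U)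

data Rewrite (Σ : Sig) : Set where
  rewr : (d : (des , ξ) ∈ Σ) (t : MSubP Σ θ 0 ξ) (r : Tm Σ θ 0) → Rewrite Σ

wkRewrite : ∀ {e} → Rewrite Σ → Rewrite (e ∷ Σ)
wkRewrite (rewr d t r) = rewr (there d) (wkMSubP t) (wkTm r)

-- A symbol is a position in the signature |𝕋|, the index of the theory, so
-- declared symbols are automatically distinct.

data Theory : Sig → Set
rewrites : Theory Σ → List (Rewrite Σ)

data Theory where
  ∅        : Theory []
  _▸_      : Theory Σ → Rule Σ k ξ → Theory ((k , ξ) ∷ Σ)
  rewrite▸ : (𝕋 : Theory Σ) (d : (des , ξ) ∈ Σ) (t : MSubP Σ θ 0 ξ) (r : Tm Σ θ 0) →
             (∀ {θ′} {t′ : MSubP Σ θ′ 0 ξ} {r′ : Tm Σ θ′ 0} →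
                rewr d t′ r′ ∈ rewrites 𝕋 →
                ∀ {θ₁ δ} (u : MSub Σ θ₁ δ θ) (u′ : MSub Σ θ₁ δ θ′) →
                ⌜ t ⌝ᴹ [ u ]ᴹ ≢ ⌜ t′ ⌝ᴹ [ u′ ]ᴹ) →
             Theory Σ

rewrites ∅                    = []
rewrites (𝕋 ▸ R)              = map wkRewrite (rewrites 𝕋)
rewrites (rewrite▸ 𝕋 d t r _) = rewr d t r ∷ rewrites 𝕋

rule : Theory Σ → (k , ξ) ∈ Σ → Rule Σ k ξ
rule (𝕋 ▸ R)              (here refl) = wkRule R
rule (𝕋 ▸ R)              (there o)   = wkRule (rule 𝕋 o)
rule (rewrite▸ 𝕋 d t r _) o           = rule 𝕋 o

data _⊢_⟶_  (𝕋 : Theory Σ) : Tm Σ θ γ → Tm Σ θ γ → Set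
data _⊢_⟶ˢ_ (𝕋 : Theory Σ) : Sub Σ θ γ δ → Sub Σ θ γ δ → Set
data _⊢_⟶ᴹ_ (𝕋 : Theory Σ) : MSub Σ θ γ ξ → MSub Σ θ γ ξ → Set

data _⊢_⟶_ {Σ} 𝕋 where
  rewr : {d : (des , ξ) ∈ Σ} {u : MSubP Σ θ₁ 0 ξ} {r : Tm Σ θ₁ 0} →
         rewr d u r ∈ rewrites 𝕋 → (t : MSub Σ θ γ θ₁) →
         𝕋 ⊢ op d (⌜ u ⌝ᴹ [ t ]ᴹ) ⟶ r [ t ]
  mvar : {x : δ ∈ θ} {σ σ′ : Sub Σ θ γ δ} →
         𝕋 ⊢ σ ⟶ˢ σ′ → 𝕋 ⊢ mvar x σ ⟶ mvar x σ′
  op   : {o : (k , ξ) ∈ Σ} {t t′ : MSub Σ θ γ ξ} →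
         𝕋 ⊢ t ⟶ᴹ t′ → 𝕋 ⊢ op o t ⟶ op o t′

data _⊢_⟶ˢ_ {Σ} 𝕋 where
  here  : {σ : Sub Σ θ γ δ} {t t′ : Tm Σ θ γ} →
          𝕋 ⊢ t ⟶ t′ → 𝕋 ⊢ σ ▸ t ⟶ˢ σ ▸ t′
  there : {σ σ′ : Sub Σ θ γ δ} {t : Tm Σ θ γ} →
          𝕋 ⊢ σ ⟶ˢ σ′ → 𝕋 ⊢ σ ▸ t ⟶ˢ σ′ ▸ t

data _⊢_⟶ᴹ_ {Σ} 𝕋 where
  here  : {u : MSub Σ θ γ ξ} {t t′ : Tm Σ θ (δ + γ)} →
          𝕋 ⊢ t ⟶ t′ → 𝕋 ⊢ MSub._▸_ {δ = δ} u t ⟶ᴹ u ▸ t′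
  there : {u u′ : MSub Σ θ γ ξ} {t : Tm Σ θ (δ + γ)} →
          𝕋 ⊢ u ⟶ᴹ u′ → 𝕋 ⊢ MSub._▸_ {δ = δ} u t ⟶ᴹ u′ ▸ t

_⊢_≈_ : Theory Σ → Tm Σ θ γ → Tm Σ θ γ → Set
𝕋 ⊢ T ≈ U = EqClosure (𝕋 ⊢_⟶_) T U

lookupTy : Ctx Σ θ 0 γ → Fin γ → Tm Σ θ γ
lookupTy (Γ ▸ T) zero    = renTm suc T
lookupTy (Γ ▸ T) (suc x) = renTm suc (lookupTy Γ x)

lookupMCtx : MCtx Σ [] θ → δ ∈ θ → Ctx Σ θ 0 δ
lookupMCtx (Θ ▹ Γ ⦂ T) (here refl) = mrenCtx there Γ
lookupMCtx (Θ ▹ Γ ⦂ T) (there x)   = mrenCtx there (lookupMCtx Θ x)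

lookupMTy : MCtx Σ [] θ → δ ∈ θ → Tm Σ θ δ
lookupMTy (Θ ▹ Γ ⦂ T) (here refl) = mrenTm there T
lookupMTy (Θ ▹ Γ ⦂ T) (there x)   = mrenTm there (lookupMTy Θ x)

-- Judgement forms 𝒥 that may follow  Θ;Γ ⊢ , for |Θ| = θ and |Γ| = γ.

data Judgement (Σ : Sig) (θ : MScope) (γ : Scope) : Set where
  ctx  : Judgement Σ θ γ
  sort : Tm Σ θ γ → Judgement Σ θ γ
  _∶_  : Tm Σ θ γ → Tm Σ θ γ → Judgement Σ θ γ
  _∶ˢ_ : Sub Σ θ γ δ → Ctx Σ θ 0 δ → Judgement Σ θ γ
  _∶ᴹ_ : MSub Σ θ γ ξ → MCtx Σ [] ξ → Judgement Σ θ γ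

data _∣_⊢     (𝕋 : Theory Σ) : MCtx Σ [] θ → Set
data _∣_⨟_⊢_ (𝕋 : Theory Σ) : MCtx Σ [] θ → Ctx Σ θ 0 γ → Judgement Σ θ γ → Set

data _∣_⊢ {Σ} 𝕋 where
  empty  : 𝕋 ∣ [] ⊢
  extend : {Θ : MCtx Σ [] θ} {Γ : Ctx Σ θ 0 γ} {T : Tm Σ θ γ} →
           𝕋 ∣ Θ ⨟ Γ ⊢ sort T →
           𝕋 ∣ Θ ▹ Γ ⦂ T ⊢

data _∣_⨟_⊢_ {Σ} 𝕋 where
  ctx-empty  : {Θ : MCtx Σ [] θ} →
               𝕋 ∣ Θ ⊢ →
               𝕋 ∣ Θ ⨟ [] ⊢ ctx
  ctx-extend : {Θ : MCtx Σ [] θ} {Γ : Ctx Σ θ 0 γ} {T : Tm Σ θ γ} →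
               𝕋 ∣ Θ ⨟ Γ ⊢ sort T →
               𝕋 ∣ Θ ⨟ Γ ▸ T ⊢ ctx

  Sort : {Θ : MCtx Σ [] θ} {Γ : Ctx Σ θ 0 γ}
         {c : (con , ξ) ∈ Σ} {Ξ : MCtx Σ [] ξ} {t : MSub Σ θ γ ξ} →
         rule 𝕋 c ≡ sortRule Ξ →
         𝕋 ∣ Θ ⨟ Γ ⊢ t ∶ᴹ Ξ →
         𝕋 ∣ Θ ⨟ Γ ⊢ sort (op c t)

  Var  : {Θ : MCtx Σ [] θ} {Γ : Ctx Σ θ 0 γ} (x : Fin γ) →
         𝕋 ∣ Θ ⨟ Γ ⊢ ctx →
         𝕋 ∣ Θ ⨟ Γ ⊢ var x ∶ lookupTy Γ x

  MVar : {Θ : MCtx Σ [] θ} {Γ : Ctx Σ θ 0 γ} (x : δ ∈ θ) {σ : Sub Σ θ γ δ} →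
         𝕋 ∣ Θ ⨟ Γ ⊢ σ ∶ˢ lookupMCtx Θ x →
         𝕋 ∣ Θ ⨟ Γ ⊢ mvar x σ ∶ subTm σ (lookupMTy Θ x)

  Cons : ∀ {θp ξc ξi} {Θ : MCtx Σ [] θ} {Γ : Ctx Σ θ 0 γ}
         {c : (con , ξc) ∈ Σ}
         {Ξp : MCtx Σ [] θp} {Ξc : MCtx Σ θp (ξc ++ θp)} {Ξi : MCtx Σ θp (ξi ++ θp)}
         {vi : MSub Σ (ξc ++ θp) 0 ξi} {T : TmP Σ (ξi ++ θp) 0}
         {tp : MSub Σ θ γ θp} {t : MSub Σ θ γ ξc} →
         rule 𝕋 c ≡ consRule Ξp Ξc Ξi vi T →
         𝕋 ∣ Θ ⨟ Γ ⊢ tp ⧺ t ∶ᴹ Ξp ⧺ᴹ Ξc →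
         𝕋 ∣ Θ ⨟ Γ ⊢ sort (⌜ T ⌝ [ tp ⧺ (vi [ tp ⧺ t ]ᴹ) ]) →
         𝕋 ∣ Θ ⨟ Γ ⊢ op c t ∶ ⌜ T ⌝ [ tp ⧺ (vi [ tp ⧺ t ]ᴹ) ]

  -- The argument of d is split into its principal argument t and the rest td.
  Dest : ∀ {θpi ξd} {Θ : MCtx Σ [] θ} {Γ : Ctx Σ θ 0 γ}
         {d : (des , ξd ++ 0 ∷ []) ∈ Σ}
         {Ξpi : MCtx Σ [] θpi} {T : TmP Σ θpi 0}
         {Ξd : MCtx Σ (0 ∷ θpi) (ξd ++ 0 ∷ θpi)} {U : Tm Σ (ξd ++ 0 ∷ θpi) 0}
         {tpi : MSub Σ θ γ θpi} {t : Tm Σ θ γ} {td : MSub Σ θ γ ξd} →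
         rule 𝕋 d ≡ destRule Ξpi T Ξd U →
         𝕋 ∣ Θ ⨟ Γ ⊢ (tpi ▸ t) ⧺ td ∶ᴹ (Ξpi ▹ [] ⦂ ⌜ T ⌝) ⧺ᴹ Ξd →
         𝕋 ∣ Θ ⨟ Γ ⊢ op d ((ε ▸ t) ⧺ td) ∶ U [ (tpi ▸ t) ⧺ td ]

  Conv : {Θ : MCtx Σ [] θ} {Γ : Ctx Σ θ 0 γ} {t T U : Tm Σ θ γ} →
         𝕋 ∣ Θ ⨟ Γ ⊢ t ∶ T →
         𝕋 ⊢ T ≈ U →
         𝕋 ∣ Θ ⨟ Γ ⊢ sort U →
         𝕋 ∣ Θ ⨟ Γ ⊢ t ∶ U

  sub-empty  : {Θ : MCtx Σ [] θ} {Γ : Ctx Σ θ 0 γ} →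
               𝕋 ∣ Θ ⨟ Γ ⊢ ctx →
               𝕋 ∣ Θ ⨟ Γ ⊢ ε ∶ˢ []
  sub-extend : {Θ : MCtx Σ [] θ} {Γ : Ctx Σ θ 0 γ} {Δ : Ctx Σ θ 0 δ}
               {σ : Sub Σ θ γ δ} {t : Tm Σ θ γ} {T : Tm Σ θ δ} →
               𝕋 ∣ Θ ⨟ Γ ⊢ σ ∶ˢ Δ →
               𝕋 ∣ Θ ⨟ Γ ⊢ t ∶ subTm σ T →
               𝕋 ∣ Θ ⨟ Γ ⊢ σ ▸ t ∶ˢ Δ ▸ T

  msub-empty  : {Θ : MCtx Σ [] θ} {Γ : Ctx Σ θ 0 γ} →
                𝕋 ∣ Θ ⨟ Γ ⊢ ctx →
                𝕋 ∣ Θ ⨟ Γ ⊢ ε ∶ᴹ []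
  msub-extend : {Θ : MCtx Σ [] θ} {Γ : Ctx Σ θ 0 γ} {Ξ : MCtx Σ [] ξ}
                {Δ : Ctx Σ ξ 0 δ} {T : Tm Σ ξ δ}
                {u : MSub Σ θ γ ξ} {t : Tm Σ θ (δ + γ)} →
                𝕋 ∣ Θ ⨟ Γ ⊢ u ∶ᴹ Ξ →
                𝕋 ∣ Θ ⨟ Γ ⧺ᶜ (Δ [ u ]ᶜ) ⊢ t ∶ T [ u ] →
                𝕋 ∣ Θ ⨟ Γ ⊢ u ▸ t ∶ᴹ Ξ ▹ Δ ⦂ T

-- An order-preserving selection of entries.  A kept entry of the larger context
-- is the entry of the smaller one, weakened along the inclusion of the variables
-- (emb) resp. metavariables (embᴹ) selected before it.

data _⊑_ {Σ : Sig} {θ : MScope} : Ctx Σ θ 0 γ → Ctx Σ θ 0 δ → Set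
emb : {Γ : Ctx Σ θ 0 γ} {Δ : Ctx Σ θ 0 δ} → Γ ⊑ Δ → Ren γ δ

data _⊑_ {Σ} {θ} where
  empty : [] ⊑ []
  keep  : {Γ : Ctx Σ θ 0 γ} {Δ : Ctx Σ θ 0 δ} {T : Tm Σ θ γ}
          (ι : Γ ⊑ Δ) → Γ ▸ T ⊑ Δ ▸ renTm (emb ι) T
  drop  : {Γ : Ctx Σ θ 0 γ} {Δ : Ctx Σ θ 0 δ} {U : Tm Σ θ δ}
          (ι : Γ ⊑ Δ) → Γ ⊑ Δ ▸ U

emb empty            = id
emb (keep ι) zero    = zero
emb (keep ι) (suc x) = suc (emb ι x)
emb (drop ι) x       = suc (emb ι x)

data _⊑ᴹ_ {Σ : Sig} : MCtx Σ [] θ → MCtx Σ [] ξ → Set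
embᴹ : {Θ : MCtx Σ [] θ} {Ξ : MCtx Σ [] ξ} → Θ ⊑ᴹ Ξ → MRen θ ξ

data _⊑ᴹ_ {Σ} where
  empty : [] ⊑ᴹ []
  keep  : {Θ : MCtx Σ [] θ} {Ξ : MCtx Σ [] ξ} {Γ : Ctx Σ θ 0 γ} {T : Tm Σ θ γ}
          (ι : Θ ⊑ᴹ Ξ) → Θ ▹ Γ ⦂ T ⊑ᴹ Ξ ▹ mrenCtx (embᴹ ι) Γ ⦂ mrenTm (embᴹ ι) T
  drop  : {Θ : MCtx Σ [] θ} {Ξ : MCtx Σ [] ξ} {Γ : Ctx Σ ξ 0 γ} {T : Tm Σ ξ γ}
          (ι : Θ ⊑ᴹ Ξ) → Θ ⊑ᴹ Ξ ▹ Γ ⦂ T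

embᴹ empty    x           = x
embᴹ (keep ι) (here refl) = here refl
embᴹ (keep ι) (there x)   = there (embᴹ ι x)
embᴹ (drop ι) x           = there (embᴹ ι x)

-- Types of substitutions and of metavariable substitutions live in the empty
-- scope, and the latter also in the empty metavariable scope.

ren𝒥 : Ren γ γ′ → Judgement Σ θ γ → Judgement Σ θ γ′
ren𝒥 ρ ctx      = ctx
ren𝒥 ρ (sort T) = sort (renTm ρ T)
ren𝒥 ρ (t ∶ T)  = renTm ρ t ∶ renTm ρ T
ren𝒥 ρ (σ ∶ˢ Δ) = renSub ρ σ ∶ˢ Δ
ren𝒥 ρ (u ∶ᴹ Ξ) = renMSub ρ u ∶ᴹ Ξ

mren𝒥 : MRen θ θ′ → Judgement Σ θ γ → Judgement Σ θ′ γ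
mren𝒥 μ ctx      = ctx
mren𝒥 μ (sort T) = sort (mrenTm μ T)
mren𝒥 μ (t ∶ T)  = mrenTm μ t ∶ mrenTm μ T
mren𝒥 μ (σ ∶ˢ Δ) = mrenSub μ σ ∶ˢ mrenCtx μ Δ
mren𝒥 μ (u ∶ᴹ Ξ) = mrenMSub μ u ∶ᴹ Ξ

{-# OPTIONS --safe #-}
module Submission where

open import Data.Fin using (Fin; zero; suc; _↑ˡ_; _↑ʳ_)
open import Data.List using ([])
open import Data.List.Membership.Propositional using (_∈_)
open import Data.List.Relation.Unary.Any using (here; there)
open import Data.Nat using (zero; suc)
open import Data.Product using (_×_; _,_; proj₁; proj₂)
open import Data.Unit using (⊤; tt)
open import Function using (_∘_)
open import Relation.Binary.Construct.Closure.Equivalence using (gmap)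
open import Relation.Binary.PropositionalEquality
  using (_≡_; _≗_; refl; sym; trans; cong; cong₂; subst; subst₂; module ≡-Reasoning)
open import Defs

open ≡-Reasoning

-- Part (1): weakening along a renaming ρ with Δ(ρ x) = Γ(x)[ρ], a notion that,
-- unlike ⊑, is stable under lifting ρ through a binder without transporting
-- along equations between types.  Under a metavariable binder one needs
-- well-formedness of the extended target context; it comes from weakening the
-- types of the extension.  Those weakenings are not premises of the rule, so the
-- induction also carries along, for every judgement over Γ, the weakenability
-- of each type occurring in Γ (WeakensTypes), which keeps it structural.
--
-- Part (2) needs no such care, as the target metavariable context never grows.

-- Renaming

-- The composite enters as a separate `τ` with a pointwise equation because `lift δ ρ ∘ lift δ σ`
-- and `lift δ (ρ ∘ σ)` agree only pointwise. A hypothesis of this shape can be carried under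
-- binders without function extensionality, and the later lemmas on renamings use the same form.
lift-∘ : ∀ δ {ρ : Ren γ₂ γ₃} {σ : Ren γ₁ γ₂} {τ : Ren γ₁ γ₃} →
         ρ ∘ σ ≗ τ → lift δ ρ ∘ lift δ σ ≗ lift δ τ
lift-∘ zero    h x       = h x
lift-∘ (suc δ) h zero    = refl
lift-∘ (suc δ) h (suc x) = cong suc (lift-∘ δ h x)

renTm-renTm     : {ρ : Ren γ₂ γ₃} {σ : Ren γ₁ γ₂} {τ : Ren γ₁ γ₃} → ρ ∘ σ ≗ τ →
                  (t : Tm Σ θ γ₁) → renTm ρ (renTm σ t) ≡ renTm τ t
renSub-renSub   : {ρ : Ren γ₂ γ₃} {σ : Ren γ₁ γ₂} {τ : Ren γ₁ γ₃} → ρ ∘ σ ≗ τ →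
                  (s : Sub Σ θ γ₁ δ) → renSub ρ (renSub σ s) ≡ renSub τ s
renMSub-renMSub : {ρ : Ren γ₂ γ₃} {σ : Ren γ₁ γ₂} {τ : Ren γ₁ γ₃} → ρ ∘ σ ≗ τ →
                  (u : MSub Σ θ γ₁ ξ) → renMSub ρ (renMSub σ u) ≡ renMSub τ u

renTm-renTm h (var x)    = cong var (h x)
renTm-renTm h (mvar x s) = cong (mvar x) (renSub-renSub h s)
renTm-renTm h (op o u)   = cong (op o) (renMSub-renMSub h u)

renSub-renSub h ε       = refl
renSub-renSub h (s ▸ t) = cong₂ _▸_ (renSub-renSub h s) (renTm-renTm h t)

renMSub-renMSub h ε                 = refl
renMSub-renMSub h (_▸_ {δ = δ} u t) =
  cong₂ _▸_ (renMSub-renMSub h u) (renTm-renTm (lift-∘ δ h) t)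

-- Both sides are compared with renaming along `ρ′ ∘ σ′`. The typical square is `suc` against a
-- lifted or embedded renaming; it commutes by computation, so `h` is then `λ _ → refl`.
renTm-comm  : {ρ : Ren γ₂ γ₃} {σ : Ren γ₁ γ₂} {ρ′ : Ren γ γ₃} {σ′ : Ren γ₁ γ} →
              ρ ∘ σ ≗ ρ′ ∘ σ′ → (t : Tm Σ θ γ₁) →
              renTm ρ (renTm σ t) ≡ renTm ρ′ (renTm σ′ t)
renTm-comm h t = trans (renTm-renTm h t) (sym (renTm-renTm (λ _ → refl) t))

renSub-comm : {ρ : Ren γ₂ γ₃} {σ : Ren γ₁ γ₂} {ρ′ : Ren γ γ₃} {σ′ : Ren γ₁ γ} →
              ρ ∘ σ ≗ ρ′ ∘ σ′ → (s : Sub Σ θ γ₁ δ) →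
              renSub ρ (renSub σ s) ≡ renSub ρ′ (renSub σ′ s)
renSub-comm h s = trans (renSub-renSub h s) (sym (renSub-renSub (λ _ → refl) s))

lookupSub-renSub : (ρ : Ren γ₁ γ₂) (s : Sub Σ θ γ₁ δ) (x : Fin δ) →
                   lookupSub (renSub ρ s) x ≡ renTm ρ (lookupSub s x)
lookupSub-renSub ρ (s ▸ t) zero    = refl
lookupSub-renSub ρ (s ▸ t) (suc x) = lookupSub-renSub ρ s x

lookupMSub-renMSub : (ρ : Ren γ₁ γ₂) (u : MSub Σ θ γ₁ ξ) (x : δ ∈ ξ) →
                     lookupMSub (renMSub ρ u) x ≡ renTm (lift δ ρ) (lookupMSub u x)
lookupMSub-renMSub ρ (u ▸ t) (here refl) = refl
lookupMSub-renMSub ρ (u ▸ t) (there x)   = lookupMSub-renMSub ρ u x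

renSub-⧺ˢ : (ρ : Ren γ₁ γ₂) (s : Sub Σ θ γ₁ δ₁) (r : Sub Σ θ γ₁ δ₂) →
            renSub ρ (s ⧺ˢ r) ≡ renSub ρ s ⧺ˢ renSub ρ r
renSub-⧺ˢ ρ s ε       = refl
renSub-⧺ˢ ρ s (r ▸ t) = cong (_▸ renTm ρ t) (renSub-⧺ˢ ρ s r)

renMSub-⧺ : (ρ : Ren γ₁ γ₂) (u : MSub Σ θ γ₁ ξ₁) (v : MSub Σ θ γ₁ ξ₂) →
            renMSub ρ (u ⧺ v) ≡ renMSub ρ u ⧺ renMSub ρ v
renMSub-⧺ ρ u ε                 = refl
renMSub-⧺ ρ u (_▸_ {δ = δ} v t) = cong (_▸ renTm (lift δ ρ) t) (renMSub-⧺ ρ u v)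

-- Renaming and substitution

renSub-liftSub : ∀ δ (ρ : Ren γ₁ γ₂) (s : Sub Σ θ γ₁ γ) →
                 renSub (lift δ ρ) (liftSub δ s) ≡ liftSub δ (renSub ρ s)
renSub-liftSub zero    ρ s = refl
renSub-liftSub (suc δ) ρ s = cong (_▸ var zero)
  (trans (renSub-comm (λ _ → refl) (liftSub δ s)) (cong (renSub suc) (renSub-liftSub δ ρ s)))

renTm-subTm     : (ρ : Ren γ₁ γ₂) (s : Sub Σ θ γ₁ γ) (t : Tm Σ θ γ) →
                  renTm ρ (subTm s t) ≡ subTm (renSub ρ s) t
renSub-subSub   : (ρ : Ren γ₁ γ₂) (s : Sub Σ θ γ₁ γ) (r : Sub Σ θ γ δ) →
                  renSub ρ (subSub s r) ≡ subSub (renSub ρ s) r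
renMSub-subMSub : (ρ : Ren γ₁ γ₂) (s : Sub Σ θ γ₁ γ) (u : MSub Σ θ γ ξ) →
                  renMSub ρ (subMSub s u) ≡ subMSub (renSub ρ s) u

renTm-subTm ρ s (var x)    = sym (lookupSub-renSub ρ s x)
renTm-subTm ρ s (mvar x r) = cong (mvar x) (renSub-subSub ρ s r)
renTm-subTm ρ s (op o u)   = cong (op o) (renMSub-subMSub ρ s u)

renSub-subSub ρ s ε       = refl
renSub-subSub ρ s (r ▸ t) = cong₂ _▸_ (renSub-subSub ρ s r) (renTm-subTm ρ s t)

renMSub-subMSub ρ s ε                 = refl
renMSub-subMSub ρ s (_▸_ {δ = δ} u t) = cong₂ _▸_ (renMSub-subMSub ρ s u)
  (trans (renTm-subTm (lift δ ρ) (liftSub δ s) t)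
         (cong (λ r → subTm r t) (renSub-liftSub δ ρ s)))

-- Here `r` stands for the composite of `s` with `ρ`, described by its lookups alone. This lemma
-- keeps that description valid under binders, which is what `subMSub-renMSub` requires.
lookupSub-liftSub : ∀ δ {s : Sub Σ θ γ γ₂} {ρ : Ren γ₁ γ₂} {r : Sub Σ θ γ γ₁} →
                    lookupSub s ∘ ρ ≗ lookupSub r →
                    lookupSub (liftSub δ s) ∘ lift δ ρ ≗ lookupSub (liftSub δ r)
lookupSub-liftSub zero    h x       = h x
lookupSub-liftSub (suc δ) h zero    = refl
lookupSub-liftSub (suc δ) {s} {ρ} {r} h (suc x) = begin
  lookupSub (renSub suc (liftSub δ s)) (lift δ ρ x)  ≡⟨ lookupSub-renSub suc (liftSub δ s) (lift δ ρ x) ⟩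
  renTm suc (lookupSub (liftSub δ s) (lift δ ρ x))   ≡⟨ cong (renTm suc) (lookupSub-liftSub δ h x) ⟩
  renTm suc (lookupSub (liftSub δ r) x)              ≡⟨ lookupSub-renSub suc (liftSub δ r) x ⟨
  lookupSub (renSub suc (liftSub δ r)) x             ∎

subTm-renTm     : {s : Sub Σ θ γ γ₂} {ρ : Ren γ₁ γ₂} {r : Sub Σ θ γ γ₁} →
                  lookupSub s ∘ ρ ≗ lookupSub r →
                  (t : Tm Σ θ γ₁) → subTm s (renTm ρ t) ≡ subTm r t
subSub-renSub   : {s : Sub Σ θ γ γ₂} {ρ : Ren γ₁ γ₂} {r : Sub Σ θ γ γ₁} →
                  lookupSub s ∘ ρ ≗ lookupSub r →
                  (q : Sub Σ θ γ₁ δ) → subSub s (renSub ρ q) ≡ subSub r q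
subMSub-renMSub : {s : Sub Σ θ γ γ₂} {ρ : Ren γ₁ γ₂} {r : Sub Σ θ γ γ₁} →
                  lookupSub s ∘ ρ ≗ lookupSub r →
                  (u : MSub Σ θ γ₁ ξ) → subMSub s (renMSub ρ u) ≡ subMSub r u

subTm-renTm h (var x)    = h x
subTm-renTm h (mvar x q) = cong (mvar x) (subSub-renSub h q)
subTm-renTm h (op o u)   = cong (op o) (subMSub-renMSub h u)

subSub-renSub h ε       = refl
subSub-renSub h (q ▸ t) = cong₂ _▸_ (subSub-renSub h q) (subTm-renTm h t)

subMSub-renMSub h ε                 = refl
subMSub-renMSub h (_▸_ {δ = δ} u t) =
  cong₂ _▸_ (subMSub-renMSub h u) (subTm-renTm (lookupSub-liftSub δ h) t)

-- Renaming and instantiation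

lookupSub-vars : (ρ : Ren δ γ) (x : Fin δ) → lookupSub (vars {Σ = Σ} {θ = θ} ρ) x ≡ var (ρ x)
lookupSub-vars ρ zero    = refl
lookupSub-vars ρ (suc x) = lookupSub-vars (ρ ∘ suc) x

-- `lift δ ρ` fixes the `δ` positions filled by `r` and acts as `ρ` on those of `s`. This is the
-- situation when a metavariable is instantiated: `r` holds its arguments, and `s` the variables of
-- the ambient scope.
lookupSub-⧺ˢ-lift : {s : Sub Σ θ γ δ₂} {ρ : Ren δ₁ δ₂} {s′ : Sub Σ θ γ δ₁} →
                    lookupSub s ∘ ρ ≗ lookupSub s′ → (r : Sub Σ θ γ δ) →
                    lookupSub (s ⧺ˢ r) ∘ lift δ ρ ≗ lookupSub (s′ ⧺ˢ r)
lookupSub-⧺ˢ-lift h ε       x       = h x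
lookupSub-⧺ˢ-lift h (r ▸ t) zero    = refl
lookupSub-⧺ˢ-lift h (r ▸ t) (suc x) = lookupSub-⧺ˢ-lift h r x

lift-↑ʳ : ∀ δ (ρ : Ren γ γ′) x → lift δ ρ (δ ↑ʳ x) ≡ δ ↑ʳ ρ x
lift-↑ʳ zero    ρ x = refl
lift-↑ʳ (suc δ) ρ x = cong suc (lift-↑ʳ δ ρ x)

lift-↑ˡ : (ρ : Ren γ γ′) (x : Fin δ) → lift δ ρ (x ↑ˡ γ) ≡ x ↑ˡ γ′
lift-↑ˡ ρ zero    = refl
lift-↑ˡ ρ (suc x) = cong suc (lift-↑ˡ ρ x)

module _ {Σ θ₁ θ₂ δ₁ δ₂} (v : MSub Σ θ₁ δ₁ θ₂) {σ : Ren δ₁ δ₂} where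

  -- Instantiation is natural in the scope of `v`. The first condition says that `τ` acts as `σ` on
  -- the variables coming from `v`, the second that it carries the inclusion `ρ` of the instantiated
  -- expression's own variables to `ρ′`. All inclusions are arbitrary because `instMSub` changes
  -- them at each binder.
  renTm-instTm     : {w : Ren δ₁ γ₁} {w′ : Ren δ₂ γ₂} {τ : Ren γ₁ γ₂}
                     {ρ : Ren γ γ₁} {ρ′ : Ren γ γ₂} →
                     τ ∘ w ≗ w′ ∘ σ → τ ∘ ρ ≗ ρ′ → (t : Tm Σ θ₂ γ) →
                     renTm τ (instTm v w ρ t) ≡ instTm (renMSub σ v) w′ ρ′ t
  renSub-instSub   : {w : Ren δ₁ γ₁} {w′ : Ren δ₂ γ₂} {τ : Ren γ₁ γ₂}
                     {ρ : Ren γ γ₁} {ρ′ : Ren γ γ₂} →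
                     τ ∘ w ≗ w′ ∘ σ → τ ∘ ρ ≗ ρ′ → (s : Sub Σ θ₂ γ δ) →
                     renSub τ (instSub v w ρ s) ≡ instSub (renMSub σ v) w′ ρ′ s
  renMSub-instMSub : {w : Ren δ₁ γ₁} {w′ : Ren δ₂ γ₂} {τ : Ren γ₁ γ₂}
                     {ρ : Ren γ γ₁} {ρ′ : Ren γ γ₂} →
                     τ ∘ w ≗ w′ ∘ σ → τ ∘ ρ ≗ ρ′ → (u : MSub Σ θ₂ γ ξ) →
                     renMSub τ (instMSub v w ρ u) ≡ instMSub (renMSub σ v) w′ ρ′ u

  renTm-instTm hw hρ (var x) = cong var (hρ x)
  renTm-instTm {w = w} {w′} {τ} {ρ} {ρ′} hw hρ (mvar {δ = δ} x s) = begin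
    renTm τ (subTm (vars w ⧺ˢ instSub v w ρ s) t)
      ≡⟨ renTm-subTm τ (vars w ⧺ˢ instSub v w ρ s) t ⟩
    subTm (renSub τ (vars w ⧺ˢ instSub v w ρ s)) t
      ≡⟨ cong (λ r → subTm r t) (renSub-⧺ˢ τ (vars w) (instSub v w ρ s)) ⟩
    subTm (renSub τ (vars w) ⧺ˢ renSub τ (instSub v w ρ s)) t
      ≡⟨ cong (λ r → subTm (renSub τ (vars w) ⧺ˢ r) t) (renSub-instSub hw hρ s) ⟩
    subTm (renSub τ (vars w) ⧺ˢ s′) t
      -- The renaming moves from the substitution onto the entry of `v`: `lift δ σ` leaves the
      -- arguments `s′` alone, and `vars-agree`, which is `hw` read as an equation of terms, handles
      -- the ambient variables.
      ≡⟨ subTm-renTm (lookupSub-⧺ˢ-lift vars-agree s′) t ⟨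
    subTm (vars w′ ⧺ˢ s′) (renTm (lift δ σ) t)
      ≡⟨ cong (subTm (vars w′ ⧺ˢ s′)) (lookupMSub-renMSub σ v x) ⟨
    subTm (vars w′ ⧺ˢ s′) (lookupMSub (renMSub σ v) x)
      ∎
    where
    t  = lookupMSub v x
    s′ = instSub (renMSub σ v) w′ ρ′ s

    vars-agree : lookupSub (vars w′) ∘ σ ≗ lookupSub (renSub τ (vars w))
    vars-agree y = begin
      lookupSub (vars w′) (σ y)        ≡⟨ lookupSub-vars w′ (σ y) ⟩
      var (w′ (σ y))                   ≡⟨ cong var (hw y) ⟨
      renTm τ (var (w y))              ≡⟨ cong (renTm τ) (lookupSub-vars w y) ⟨
      renTm τ (lookupSub (vars w) y)   ≡⟨ lookupSub-renSub τ (vars w) y ⟨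
      lookupSub (renSub τ (vars w)) y  ∎
  renTm-instTm hw hρ (op o u) = cong (op o) (renMSub-instMSub hw hρ u)

  renSub-instSub hw hρ ε       = refl
  renSub-instSub hw hρ (s ▸ t) = cong₂ _▸_ (renSub-instSub hw hρ s) (renTm-instTm hw hρ t)

  renMSub-instMSub hw hρ ε = refl
  renMSub-instMSub {w = w} {τ = τ} hw hρ (_▸_ {δ = δ} u t) = cong₂ _▸_
    (renMSub-instMSub hw hρ u)
    -- Under the binder `w` becomes `(δ ↑ʳ_) ∘ w` and `τ` becomes `lift δ τ`; `lift-↑ʳ` commutes the
    -- two and reduces the first condition to `hw`.
    (renTm-instTm (λ x → trans (lift-↑ʳ δ τ (w x)) (cong (δ ↑ʳ_) (hw x))) (lift-∘ δ hρ) t)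

  -- At `γ = 0` the renaming `lift γ σ` is `σ` by computation, so this applies without transport to
  -- the components of rules, which live in the empty scope.
  renTm-[] : (t : Tm Σ θ₂ γ) → renTm (lift γ σ) (t [ v ]) ≡ t [ renMSub σ v ]
  renTm-[] {γ = γ} = renTm-instTm (lift-↑ʳ γ σ) (lift-↑ˡ σ)

  renMSub-[] : (u : MSub Σ θ₂ γ ξ) → renMSub (lift γ σ) (u [ v ]ᴹ) ≡ u [ renMSub σ v ]ᴹ
  renMSub-[] {γ = γ} = renMSub-instMSub (lift-↑ʳ γ σ) (lift-↑ˡ σ)

-- Renaming metavariables

module _ (μ : MRen θ₁ θ₂) (ν : MRen θ θ₁) where

  -- A metavariable renaming passes unchanged under binders, so the composite can be written out
  -- literally.
  mrenTm-mrenTm     : (t : Tm Σ θ γ) →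
                      mrenTm μ (mrenTm ν t) ≡ mrenTm (λ x → μ (ν x)) t
  mrenSub-mrenSub   : (s : Sub Σ θ γ δ) →
                      mrenSub μ (mrenSub ν s) ≡ mrenSub (λ x → μ (ν x)) s
  mrenMSub-mrenMSub : (u : MSub Σ θ γ ξ) →
                      mrenMSub μ (mrenMSub ν u) ≡ mrenMSub (λ x → μ (ν x)) u

  mrenTm-mrenTm (var x)    = refl
  mrenTm-mrenTm (mvar x s) = cong (mvar (μ (ν x))) (mrenSub-mrenSub s)
  mrenTm-mrenTm (op o u)   = cong (op o) (mrenMSub-mrenMSub u)

  mrenSub-mrenSub ε       = refl
  mrenSub-mrenSub (s ▸ t) = cong₂ _▸_ (mrenSub-mrenSub s) (mrenTm-mrenTm t)

  mrenMSub-mrenMSub ε       = refl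
  mrenMSub-mrenMSub (u ▸ t) = cong₂ _▸_ (mrenMSub-mrenMSub u) (mrenTm-mrenTm t)

  mrenCtx-mrenCtx : (Γ : Ctx Σ θ γ γ′) →
                    mrenCtx μ (mrenCtx ν Γ) ≡ mrenCtx (λ x → μ (ν x)) Γ
  mrenCtx-mrenCtx []      = refl
  mrenCtx-mrenCtx (Γ ▸ T) = cong₂ _▸_ (mrenCtx-mrenCtx Γ) (mrenTm-mrenTm T)

module _ (μ : MRen θ θ′) where

  mrenTm-renTm     : (ρ : Ren γ γ′) (t : Tm Σ θ γ) →
                     mrenTm μ (renTm ρ t) ≡ renTm ρ (mrenTm μ t)
  mrenSub-renSub   : (ρ : Ren γ γ′) (s : Sub Σ θ γ δ) →
                     mrenSub μ (renSub ρ s) ≡ renSub ρ (mrenSub μ s)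
  mrenMSub-renMSub : (ρ : Ren γ γ′) (u : MSub Σ θ γ ξ) →
                     mrenMSub μ (renMSub ρ u) ≡ renMSub ρ (mrenMSub μ u)

  mrenTm-renTm ρ (var x)    = refl
  mrenTm-renTm ρ (mvar x s) = cong (mvar (μ x)) (mrenSub-renSub ρ s)
  mrenTm-renTm ρ (op o u)   = cong (op o) (mrenMSub-renMSub ρ u)

  mrenSub-renSub ρ ε       = refl
  mrenSub-renSub ρ (s ▸ t) = cong₂ _▸_ (mrenSub-renSub ρ s) (mrenTm-renTm ρ t)

  mrenMSub-renMSub ρ ε                 = refl
  mrenMSub-renMSub ρ (_▸_ {δ = δ} u t) =
    cong₂ _▸_ (mrenMSub-renMSub ρ u) (mrenTm-renTm (lift δ ρ) t)

  mrenSub-vars : (ρ : Ren δ γ) → mrenSub μ (vars {Σ = Σ} ρ) ≡ vars ρ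
  mrenSub-vars {δ = zero}  ρ = refl
  mrenSub-vars {δ = suc δ} ρ = cong (_▸ var (ρ zero)) (mrenSub-vars (ρ ∘ suc))

  mrenSub-⧺ˢ : (s : Sub Σ θ γ δ₁) (r : Sub Σ θ γ δ₂) →
               mrenSub μ (s ⧺ˢ r) ≡ mrenSub μ s ⧺ˢ mrenSub μ r
  mrenSub-⧺ˢ s ε       = refl
  mrenSub-⧺ˢ s (r ▸ t) = cong (_▸ mrenTm μ t) (mrenSub-⧺ˢ s r)

  mrenMSub-⧺ : (u : MSub Σ θ γ ξ₁) (v : MSub Σ θ γ ξ₂) →
               mrenMSub μ (u ⧺ v) ≡ mrenMSub μ u ⧺ mrenMSub μ v
  mrenMSub-⧺ u ε       = refl
  mrenMSub-⧺ u (v ▸ t) = cong (_▸ mrenTm μ t) (mrenMSub-⧺ u v)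

  mrenTm-lookupSub : (s : Sub Σ θ γ δ) (x : Fin δ) →
                     mrenTm μ (lookupSub s x) ≡ lookupSub (mrenSub μ s) x
  mrenTm-lookupSub (s ▸ t) zero    = refl
  mrenTm-lookupSub (s ▸ t) (suc x) = mrenTm-lookupSub s x

  mrenTm-lookupMSub : (u : MSub Σ θ γ ξ) (x : δ ∈ ξ) →
                      mrenTm μ (lookupMSub u x) ≡ lookupMSub (mrenMSub μ u) x
  mrenTm-lookupMSub (u ▸ t) (here refl) = refl
  mrenTm-lookupMSub (u ▸ t) (there x)   = mrenTm-lookupMSub u x

  mrenSub-liftSub : ∀ δ (s : Sub Σ θ γ₁ γ₂) →
                    mrenSub μ (liftSub δ s) ≡ liftSub δ (mrenSub μ s)
  mrenSub-liftSub zero    s = refl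
  mrenSub-liftSub (suc δ) s = cong (_▸ var zero)
    (trans (mrenSub-renSub suc (liftSub δ s)) (cong (renSub suc) (mrenSub-liftSub δ s)))

  mrenTm-subTm     : (s : Sub Σ θ γ₁ γ₂) (t : Tm Σ θ γ₂) →
                     mrenTm μ (subTm s t) ≡ subTm (mrenSub μ s) (mrenTm μ t)
  mrenSub-subSub   : (s : Sub Σ θ γ₁ γ₂) (r : Sub Σ θ γ₂ δ) →
                     mrenSub μ (subSub s r) ≡ subSub (mrenSub μ s) (mrenSub μ r)
  mrenMSub-subMSub : (s : Sub Σ θ γ₁ γ₂) (u : MSub Σ θ γ₂ ξ) →
                     mrenMSub μ (subMSub s u) ≡ subMSub (mrenSub μ s) (mrenMSub μ u)

  mrenTm-subTm s (var x)    = mrenTm-lookupSub s x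
  mrenTm-subTm s (mvar x r) = cong (mvar (μ x)) (mrenSub-subSub s r)
  mrenTm-subTm s (op o u)   = cong (op o) (mrenMSub-subMSub s u)

  mrenSub-subSub s ε       = refl
  mrenSub-subSub s (r ▸ t) = cong₂ _▸_ (mrenSub-subSub s r) (mrenTm-subTm s t)

  mrenMSub-subMSub s ε                 = refl
  mrenMSub-subMSub s (_▸_ {δ = δ} u t) = cong₂ _▸_ (mrenMSub-subMSub s u)
    (trans (mrenTm-subTm (liftSub δ s) t)
           (cong (λ r → subTm r (mrenTm μ t)) (mrenSub-liftSub δ s)))

  module _ {Σ δ₁ θ₁} (v : MSub Σ θ δ₁ θ₁) where

    -- Instantiation replaces every metavariable of `t`, so those of the result all come from `v`,
    -- and `μ` acts on `v` alone.
    mrenTm-instTm     : (w : Ren δ₁ γ′) (ρ : Ren γ γ′) (t : Tm Σ θ₁ γ) →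
                        mrenTm μ (instTm v w ρ t) ≡ instTm (mrenMSub μ v) w ρ t
    mrenSub-instSub   : (w : Ren δ₁ γ′) (ρ : Ren γ γ′) (s : Sub Σ θ₁ γ δ) →
                        mrenSub μ (instSub v w ρ s) ≡ instSub (mrenMSub μ v) w ρ s
    mrenMSub-instMSub : (w : Ren δ₁ γ′) (ρ : Ren γ γ′) (u : MSub Σ θ₁ γ ξ) →
                        mrenMSub μ (instMSub v w ρ u) ≡ instMSub (mrenMSub μ v) w ρ u

    mrenTm-instTm w ρ (var x)    = refl
    mrenTm-instTm w ρ (mvar x s) = trans
      (mrenTm-subTm (vars w ⧺ˢ instSub v w ρ s) (lookupMSub v x))
      (cong₂ subTm
        (trans (mrenSub-⧺ˢ (vars w) (instSub v w ρ s))
               (cong₂ _⧺ˢ_ (mrenSub-vars w) (mrenSub-instSub w ρ s)))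
        (mrenTm-lookupMSub v x))
    mrenTm-instTm w ρ (op o u)   = cong (op o) (mrenMSub-instMSub w ρ u)

    mrenSub-instSub w ρ ε       = refl
    mrenSub-instSub w ρ (s ▸ t) = cong₂ _▸_ (mrenSub-instSub w ρ s) (mrenTm-instTm w ρ t)

    mrenMSub-instMSub w ρ ε                 = refl
    mrenMSub-instMSub w ρ (_▸_ {δ = δ} u t) = cong₂ _▸_
      (mrenMSub-instMSub w ρ u) (mrenTm-instTm ((δ ↑ʳ_) ∘ w) (lift δ ρ) t)

    mrenTm-[] : (t : Tm Σ θ₁ γ) → mrenTm μ (t [ v ]) ≡ t [ mrenMSub μ v ]
    mrenTm-[] = mrenTm-instTm _ _

    mrenMSub-[] : (u : MSub Σ θ₁ γ ξ) → mrenMSub μ (u [ v ]ᴹ) ≡ u [ mrenMSub μ v ]ᴹ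
    mrenMSub-[] = mrenMSub-instMSub _ _

    mrenCtx-[] : (Γ : Ctx Σ θ₁ γ γ′) → mrenCtx μ (Γ [ v ]ᶜ) ≡ Γ [ mrenMSub μ v ]ᶜ
    mrenCtx-[] []      = refl
    mrenCtx-[] (Γ ▸ T) = cong₂ _▸_ (mrenCtx-[] Γ) (mrenTm-[] T)

  mrenCtx-⧺ᶜ : (Γ : Ctx Σ θ γ₁ γ₂) (Δ : Ctx Σ θ γ₂ γ₃) →
               mrenCtx μ (Γ ⧺ᶜ Δ) ≡ mrenCtx μ Γ ⧺ᶜ mrenCtx μ Δ
  mrenCtx-⧺ᶜ Γ []      = refl
  mrenCtx-⧺ᶜ Γ (Δ ▸ T) = cong (_▸ mrenTm μ T) (mrenCtx-⧺ᶜ Γ Δ)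

  mrenTm-lookupTy : (Γ : Ctx Σ θ 0 γ) (x : Fin γ) →
                    mrenTm μ (lookupTy Γ x) ≡ lookupTy (mrenCtx μ Γ) x
  mrenTm-lookupTy (Γ ▸ T) zero    = mrenTm-renTm suc T
  mrenTm-lookupTy (Γ ▸ T) (suc x) =
    trans (mrenTm-renTm suc (lookupTy Γ x)) (cong (renTm suc) (mrenTm-lookupTy Γ x))

-- Stability of conversion

module _ (𝕋 : Theory Σ) where

  -- Both sides of a rewrite rule live in the empty variable scope, so renaming a redex only renames
  -- the instantiating `v` and yields an instance of the same rule.
  ⟶-ren  : (ρ : Ren γ δ) {t t′ : Tm Σ θ γ} →
           𝕋 ⊢ t ⟶ t′ → 𝕋 ⊢ renTm ρ t ⟶ renTm ρ t′
  ⟶ˢ-ren : (ρ : Ren γ₁ γ₂) {s s′ : Sub Σ θ γ₁ δ} →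
           𝕋 ⊢ s ⟶ˢ s′ → 𝕋 ⊢ renSub ρ s ⟶ˢ renSub ρ s′
  ⟶ᴹ-ren : (ρ : Ren γ δ) {u u′ : MSub Σ θ γ ξ} →
           𝕋 ⊢ u ⟶ᴹ u′ → 𝕋 ⊢ renMSub ρ u ⟶ᴹ renMSub ρ u′

  ⟶-ren ρ (rewr {d = d} {u} {r} R v) =
    subst₂ (𝕋 ⊢_⟶_) (cong (op d) (sym (renMSub-[] v ⌜ u ⌝ᴹ))) (sym (renTm-[] v r))
           (rewr R (renMSub ρ v))
  ⟶-ren ρ (mvar p) = mvar (⟶ˢ-ren ρ p)
  ⟶-ren ρ (op p)   = op (⟶ᴹ-ren ρ p)

  ⟶ˢ-ren ρ (here p)  = here (⟶-ren ρ p)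
  ⟶ˢ-ren ρ (there p) = there (⟶ˢ-ren ρ p)

  ⟶ᴹ-ren ρ (here {δ = δ} p) = here (⟶-ren (lift δ ρ) p)
  ⟶ᴹ-ren ρ (there p)        = there (⟶ᴹ-ren ρ p)

  -- The metavariables of a rule are all instantiated, so again only `v` changes.
  ⟶-mren  : (μ : MRen θ θ′) {t t′ : Tm Σ θ γ} →
            𝕋 ⊢ t ⟶ t′ → 𝕋 ⊢ mrenTm μ t ⟶ mrenTm μ t′
  ⟶ˢ-mren : (μ : MRen θ θ′) {s s′ : Sub Σ θ γ δ} →
            𝕋 ⊢ s ⟶ˢ s′ → 𝕋 ⊢ mrenSub μ s ⟶ˢ mrenSub μ s′
  ⟶ᴹ-mren : (μ : MRen θ θ′) {u u′ : MSub Σ θ γ ξ} →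
            𝕋 ⊢ u ⟶ᴹ u′ → 𝕋 ⊢ mrenMSub μ u ⟶ᴹ mrenMSub μ u′

  ⟶-mren μ (rewr {d = d} {u} {r} R v) =
    subst₂ (𝕋 ⊢_⟶_) (cong (op d) (sym (mrenMSub-[] μ v ⌜ u ⌝ᴹ))) (sym (mrenTm-[] μ v r))
           (rewr R (mrenMSub μ v))
  ⟶-mren μ (mvar p) = mvar (⟶ˢ-mren μ p)
  ⟶-mren μ (op p)   = op (⟶ᴹ-mren μ p)

  ⟶ˢ-mren μ (here p)  = here (⟶-mren μ p)
  ⟶ˢ-mren μ (there p) = there (⟶ˢ-mren μ p)

  ⟶ᴹ-mren μ (here p)  = here (⟶-mren μ p)
  ⟶ᴹ-mren μ (there p) = there (⟶ᴹ-mren μ p)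

-- Weakening of contexts

CtxRen : Ctx Σ θ 0 γ → Ren γ δ → Ctx Σ θ 0 δ → Set
CtxRen Γ ρ Δ = ∀ x → lookupTy Δ (ρ x) ≡ renTm ρ (lookupTy Γ x)

module _ (𝕋 : Theory Σ) (Θ : MCtx Σ [] θ) where

  -- The target `Δ` and `ρ` are quantified inside, so that the property can be applied at targets
  -- extended under a binder.
  Weakens : Ctx Σ θ 0 γ → Judgement Σ θ γ → Set
  Weakens {γ = γ} Γ 𝒥 = ∀ {δ} {Δ : Ctx Σ θ 0 δ} {ρ : Ren γ δ} →
    CtxRen Γ ρ Δ → 𝕋 ∣ Θ ⨟ Δ ⊢ ctx → 𝕋 ∣ Θ ⨟ Δ ⊢ ren𝒥 ρ 𝒥

  WeakensTypes : Ctx Σ θ 0 γ → Set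
  WeakensTypes []      = ⊤
  WeakensTypes (Γ ▸ T) = WeakensTypes Γ × Weakens Γ (sort T)

  -- Induction on `Δ`: weakenability of the next type, applied at the extension built so far, gives
  -- the sort judgement needed to add that type to the target.
  weaken-⧺ᶜ : {Γ : Ctx Σ θ 0 γ₁} {Γ′ : Ctx Σ θ 0 γ₂} {ρ : Ren γ₁ γ₂} (u : MSub Σ θ γ₁ ξ)
              (Δ : Ctx Σ ξ 0 δ) → WeakensTypes (Γ ⧺ᶜ (Δ [ u ]ᶜ)) →
              CtxRen Γ ρ Γ′ → 𝕋 ∣ Θ ⨟ Γ′ ⊢ ctx →
              CtxRen (Γ ⧺ᶜ (Δ [ u ]ᶜ)) (lift δ ρ) (Γ′ ⧺ᶜ (Δ [ renMSub ρ u ]ᶜ)) ×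
              𝕋 ∣ Θ ⨟ Γ′ ⧺ᶜ (Δ [ renMSub ρ u ]ᶜ) ⊢ ctx
  weaken-⧺ᶜ u [] _ h c = h , c
  weaken-⧺ᶜ {Γ = Γ} {Γ′} {ρ} u (_▸_ {γ′ = δ} Δ T) (ws , w) h c =
    h″ , ctx-extend (subst (λ A → 𝕋 ∣ Θ ⨟ _ ⊢ sort A) (renTm-[] u T) (w h′ c′))
    where
    ih = weaken-⧺ᶜ u Δ ws h c
    h′ = proj₁ ih
    c′ = proj₂ ih
    h″ : CtxRen (Γ ⧺ᶜ (Δ [ u ]ᶜ) ▸ T [ u ]) (lift (suc δ) ρ)
                (Γ′ ⧺ᶜ (Δ [ renMSub ρ u ]ᶜ) ▸ T [ renMSub ρ u ])
    h″ zero    = trans (cong (renTm suc) (sym (renTm-[] u T)))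
                       (renTm-comm (λ _ → refl) (T [ u ]))
    h″ (suc x) = trans (cong (renTm suc) (h′ x))
                       (renTm-comm (λ _ → refl) (lookupTy (Γ ⧺ᶜ (Δ [ u ]ᶜ)) x))

module _ (𝕋 : Theory Σ) {Θ : MCtx Σ [] θ} where

  -- A derivation over `Γ` always has a premise over `Γ` itself, until `ctx-extend` is reached;
  -- there the sort premise is weakened by `weakens`. Every recursive call of the two functions is
  -- on an immediate premise.
  weakensTypes : {Γ : Ctx Σ θ 0 γ} {𝒥 : Judgement Σ θ γ} →
                 𝕋 ∣ Θ ⨟ Γ ⊢ 𝒥 → WeakensTypes 𝕋 Θ Γ
  weakens      : {Γ : Ctx Σ θ 0 γ} {𝒥 : Judgement Σ θ γ} →
                 𝕋 ∣ Θ ⨟ Γ ⊢ 𝒥 → Weakens 𝕋 Θ Γ 𝒥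

  weakensTypes (ctx-empty _)     = tt
  weakensTypes (ctx-extend T)    = weakensTypes T , weakens T
  weakensTypes (Sort _ t)        = weakensTypes t
  weakensTypes (Var _ Γ)         = weakensTypes Γ
  weakensTypes (MVar _ s)        = weakensTypes s
  weakensTypes (Cons _ t _)      = weakensTypes t
  weakensTypes (Dest _ t)        = weakensTypes t
  weakensTypes (Conv t _ _)      = weakensTypes t
  weakensTypes (sub-empty Γ)     = weakensTypes Γ
  weakensTypes (sub-extend s _)  = weakensTypes s
  weakensTypes (msub-empty Γ)    = weakensTypes Γ
  weakensTypes (msub-extend u _) = weakensTypes u

  weakens (ctx-empty _)  h c = c
  weakens (ctx-extend _) h c = c
  weakens (Sort R t)     h c = Sort R (weakens t h c)
  weakens (Var x _) {ρ = ρ} h c =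
    subst (λ A → 𝕋 ∣ Θ ⨟ _ ⊢ var (ρ x) ∶ A) (h x) (Var (ρ x) c)
  weakens (MVar x {s} D) {ρ = ρ} h c =
    subst (λ A → 𝕋 ∣ Θ ⨟ _ ⊢ mvar x (renSub ρ s) ∶ A)
          (sym (renTm-subTm ρ s (lookupMTy Θ x)))
          (MVar x (weakens D h c))
  weakens (Cons {c = o} {Ξp = Ξp} {Ξc} {vi = vi} {T} {tp} {t} R D S) {ρ = ρ} h c =
    subst (λ A → 𝕋 ∣ Θ ⨟ _ ⊢ op o (renMSub ρ t) ∶ A) (sym eq)
      (Cons R (subst (λ u → 𝕋 ∣ Θ ⨟ _ ⊢ u ∶ᴹ Ξp ⧺ᴹ Ξc) (renMSub-⧺ ρ tp t) (weakens D h c))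
              (subst (λ A → 𝕋 ∣ Θ ⨟ _ ⊢ sort A) eq (weakens S h c)))
    where
    -- The pattern `⌜ T ⌝` and `vi` live in the empty scope, so `ρ` passes through both
    -- instantiations and both concatenations to `tp` and `t`. The equation serves the sort premise
    -- in one direction and the conclusion in the other.
    eq : renTm ρ (⌜ T ⌝ [ tp ⧺ (vi [ tp ⧺ t ]ᴹ) ]) ≡
         ⌜ T ⌝ [ renMSub ρ tp ⧺ (vi [ renMSub ρ tp ⧺ renMSub ρ t ]ᴹ) ]
    eq = begin
      renTm ρ (⌜ T ⌝ [ tp ⧺ (vi [ tp ⧺ t ]ᴹ) ])
        ≡⟨ renTm-[] (tp ⧺ (vi [ tp ⧺ t ]ᴹ)) ⌜ T ⌝ ⟩
      ⌜ T ⌝ [ renMSub ρ (tp ⧺ (vi [ tp ⧺ t ]ᴹ)) ]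
        ≡⟨ cong (⌜ T ⌝ [_]) (renMSub-⧺ ρ tp (vi [ tp ⧺ t ]ᴹ)) ⟩
      ⌜ T ⌝ [ renMSub ρ tp ⧺ renMSub ρ (vi [ tp ⧺ t ]ᴹ) ]
        ≡⟨ cong (λ u → ⌜ T ⌝ [ renMSub ρ tp ⧺ u ]) (renMSub-[] (tp ⧺ t) vi) ⟩
      ⌜ T ⌝ [ renMSub ρ tp ⧺ (vi [ renMSub ρ (tp ⧺ t) ]ᴹ) ]
        ≡⟨ cong (λ u → ⌜ T ⌝ [ renMSub ρ tp ⧺ (vi [ u ]ᴹ) ]) (renMSub-⧺ ρ tp t) ⟩
      ⌜ T ⌝ [ renMSub ρ tp ⧺ (vi [ renMSub ρ tp ⧺ renMSub ρ t ]ᴹ) ]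
        ∎
  weakens (Dest {d = d} {Ξpi} {T} {Ξd} {U} {tpi} {t} {td} R D) {ρ = ρ} h c =
    -- The subject is itself a concatenation, so it has to be transported together with the type.
    subst₂ (λ u A → 𝕋 ∣ Θ ⨟ _ ⊢ op d u ∶ A)
      (sym (renMSub-⧺ ρ (ε ▸ t) td))
      (sym (trans (renTm-[] ((tpi ▸ t) ⧺ td) U) (cong (U [_]) (renMSub-⧺ ρ (tpi ▸ t) td))))
      (Dest R (subst (λ u → 𝕋 ∣ Θ ⨟ _ ⊢ u ∶ᴹ (Ξpi ▹ [] ⦂ ⌜ T ⌝) ⧺ᴹ Ξd)
                     (renMSub-⧺ ρ (tpi ▸ t) td) (weakens D h c)))
  weakens (Conv t e U) {ρ = ρ} h c =
    Conv (weakens t h c) (gmap (renTm ρ) (⟶-ren 𝕋 ρ) e) (weakens U h c)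
  weakens (sub-empty _) h c = sub-empty c
  weakens (sub-extend {σ = s} {t} {T} S D) {ρ = ρ} h c =
    sub-extend (weakens S h c)
      (subst (λ A → 𝕋 ∣ Θ ⨟ _ ⊢ renTm ρ t ∶ A) (renTm-subTm ρ s T) (weakens D h c))
  weakens (msub-empty _) h c = msub-empty c
  weakens (msub-extend {δ = δ} {Δ = Δ} {T} {u} {t} S D) {ρ = ρ} h c =
    msub-extend (weakens S h c)
      (subst (λ A → 𝕋 ∣ Θ ⨟ _ ⊢ renTm (lift δ ρ) t ∶ A) (renTm-[] u T)
             (weakens D (proj₁ ext) (proj₂ ext)))
    -- The premise `D` lives over the extended context, so it supplies the weakenability of the
    -- types in `Δ [ u ]ᶜ`.
    where ext = weaken-⧺ᶜ 𝕋 Θ u Δ (weakensTypes D) h c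

-- Both `emb (keep ι) ∘ suc` and `emb (drop ι)` compute to `suc ∘ emb ι`, so each case is
-- functoriality of renaming.
emb-CtxRen : {Γ : Ctx Σ θ 0 γ} {Δ : Ctx Σ θ 0 δ} (ι : Γ ⊑ Δ) → CtxRen Γ (emb ι) Δ
emb-CtxRen (keep {T = T} ι) zero    = renTm-comm (λ _ → refl) T
emb-CtxRen (keep {Γ = Γ} ι) (suc x) =
  trans (cong (renTm suc) (emb-CtxRen ι x)) (renTm-comm (λ _ → refl) (lookupTy Γ x))
emb-CtxRen {Γ = Γ} (drop ι) x =
  trans (cong (renTm suc) (emb-CtxRen ι x)) (renTm-renTm (λ _ → refl) (lookupTy Γ x))

-- Weakening of metavariable contexts

-- The counterpart of `CtxRen`, with two fields because `MVar` reads off both the context and the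
-- type of a metavariable.
record MCtxRen (Θ : MCtx Σ [] θ) (μ : MRen θ ξ) (Ξ : MCtx Σ [] ξ) : Set where
  constructor mctxRen
  field
    ctxs  : (x : δ ∈ θ) → lookupMCtx Ξ (μ x) ≡ mrenCtx μ (lookupMCtx Θ x)
    types : (x : δ ∈ θ) → lookupMTy Ξ (μ x) ≡ mrenTm μ (lookupMTy Θ x)

open MCtxRen

module _ (𝕋 : Theory Σ) {Θ : MCtx Σ [] θ} {Ξ : MCtx Σ [] ξ} {μ : MRen θ ξ}
         (h : MCtxRen Θ μ Ξ) (c : 𝕋 ∣ Ξ ⊢) where

  mweakens : {Γ : Ctx Σ θ 0 γ} {𝒥 : Judgement Σ θ γ} →
             𝕋 ∣ Θ ⨟ Γ ⊢ 𝒥 → 𝕋 ∣ Ξ ⨟ mrenCtx μ Γ ⊢ mren𝒥 μ 𝒥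
  -- Well-formedness of `Ξ` is consumed here; larger contexts are rebuilt from their renamed sort
  -- premises.
  mweakens (ctx-empty _)  = ctx-empty c
  mweakens (ctx-extend T) = ctx-extend (mweakens T)
  mweakens (Sort R t)     = Sort R (mweakens t)
  mweakens {Γ = Γ} (Var x D) =
    subst (λ A → 𝕋 ∣ Ξ ⨟ _ ⊢ var x ∶ A) (sym (mrenTm-lookupTy μ Γ x)) (Var x (mweakens D))
  mweakens (MVar x {s} D) =
    subst (λ A → 𝕋 ∣ Ξ ⨟ _ ⊢ mvar (μ x) (mrenSub μ s) ∶ A)
          (trans (cong (subTm (mrenSub μ s)) (types h x))
                 (sym (mrenTm-subTm μ s (lookupMTy Θ x))))
          (MVar (μ x) (subst (λ Δ → 𝕋 ∣ Ξ ⨟ _ ⊢ mrenSub μ s ∶ˢ Δ)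
                             (sym (ctxs h x)) (mweakens D)))
  mweakens (Cons {c = o} {Ξp = Ξp} {Ξc} {vi = vi} {T} {tp} {t} R D S) =
    subst (λ A → 𝕋 ∣ Ξ ⨟ _ ⊢ op o (mrenMSub μ t) ∶ A) (sym eq)
      (Cons R (subst (λ u → 𝕋 ∣ Ξ ⨟ _ ⊢ u ∶ᴹ Ξp ⧺ᴹ Ξc) (mrenMSub-⧺ μ tp t) (mweakens D))
              (subst (λ A → 𝕋 ∣ Ξ ⨟ _ ⊢ sort A) eq (mweakens S)))
    where
    eq : mrenTm μ (⌜ T ⌝ [ tp ⧺ (vi [ tp ⧺ t ]ᴹ) ]) ≡
         ⌜ T ⌝ [ mrenMSub μ tp ⧺ (vi [ mrenMSub μ tp ⧺ mrenMSub μ t ]ᴹ) ]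
    eq = begin
      mrenTm μ (⌜ T ⌝ [ tp ⧺ (vi [ tp ⧺ t ]ᴹ) ])
        ≡⟨ mrenTm-[] μ (tp ⧺ (vi [ tp ⧺ t ]ᴹ)) ⌜ T ⌝ ⟩
      ⌜ T ⌝ [ mrenMSub μ (tp ⧺ (vi [ tp ⧺ t ]ᴹ)) ]
        ≡⟨ cong (⌜ T ⌝ [_]) (mrenMSub-⧺ μ tp (vi [ tp ⧺ t ]ᴹ)) ⟩
      ⌜ T ⌝ [ mrenMSub μ tp ⧺ mrenMSub μ (vi [ tp ⧺ t ]ᴹ) ]
        ≡⟨ cong (λ u → ⌜ T ⌝ [ mrenMSub μ tp ⧺ u ]) (mrenMSub-[] μ (tp ⧺ t) vi) ⟩
      ⌜ T ⌝ [ mrenMSub μ tp ⧺ (vi [ mrenMSub μ (tp ⧺ t) ]ᴹ) ]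
        ≡⟨ cong (λ u → ⌜ T ⌝ [ mrenMSub μ tp ⧺ (vi [ u ]ᴹ) ]) (mrenMSub-⧺ μ tp t) ⟩
      ⌜ T ⌝ [ mrenMSub μ tp ⧺ (vi [ mrenMSub μ tp ⧺ mrenMSub μ t ]ᴹ) ]
        ∎
  mweakens (Dest {d = d} {Ξpi} {T} {Ξd} {U} {tpi} {t} {td} R D) =
    subst₂ (λ u A → 𝕋 ∣ Ξ ⨟ _ ⊢ op d u ∶ A)
      (sym (mrenMSub-⧺ μ (ε ▸ t) td))
      (sym (trans (mrenTm-[] μ ((tpi ▸ t) ⧺ td) U)
                  (cong (U [_]) (mrenMSub-⧺ μ (tpi ▸ t) td))))
      (Dest R (subst (λ u → 𝕋 ∣ Ξ ⨟ _ ⊢ u ∶ᴹ (Ξpi ▹ [] ⦂ ⌜ T ⌝) ⧺ᴹ Ξd)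
                     (mrenMSub-⧺ μ (tpi ▸ t) td) (mweakens D)))
  mweakens (Conv t e U) = Conv (mweakens t) (gmap (mrenTm μ) (⟶-mren 𝕋 μ) e) (mweakens U)
  mweakens (sub-empty D) = sub-empty (mweakens D)
  mweakens (sub-extend {σ = s} {t} {T} S D) =
    sub-extend (mweakens S)
      (subst (λ A → 𝕋 ∣ Ξ ⨟ _ ⊢ mrenTm μ t ∶ A) (mrenTm-subTm μ s T) (mweakens D))
  mweakens (msub-empty D) = msub-empty (mweakens D)
  mweakens {Γ = Γ} (msub-extend {Δ = Δ} {T} {u} {t} S D) =
    msub-extend (mweakens S)
      -- `μ` leaves variable scopes alone, so the renamed extension and the required one have the
      -- same index and can be equated directly.
      (subst₂ (λ Γ′ A → 𝕋 ∣ Ξ ⨟ Γ′ ⊢ mrenTm μ t ∶ A)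
              (trans (mrenCtx-⧺ᶜ μ Γ (Δ [ u ]ᶜ)) (cong (mrenCtx μ Γ ⧺ᶜ_) (mrenCtx-[] μ u Δ)))
              (mrenTm-[] μ u T)
              (mweakens D))

-- Lookup weakens along `there`, and `embᴹ (keep ι)` after `there` computes to `there` after
-- `embᴹ ι`; both sides thus reduce to one renaming along that composite.
embᴹ-MCtxRen : {Θ : MCtx Σ [] θ} {Ξ : MCtx Σ [] ξ} (ι : Θ ⊑ᴹ Ξ) → MCtxRen Θ (embᴹ ι) Ξ
embᴹ-MCtxRen empty = mctxRen (λ ()) (λ ())
embᴹ-MCtxRen (keep {Θ = Θ} {Γ = Γ} {T} ι) = mctxRen
  (λ { (here refl) → trans (mrenCtx-mrenCtx there (embᴹ ι) Γ)
                           (sym (mrenCtx-mrenCtx (embᴹ (keep ι)) there Γ))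
     ; (there x)   → trans (cong (mrenCtx there) (ctxs (embᴹ-MCtxRen ι) x))
                    (trans (mrenCtx-mrenCtx there (embᴹ ι) (lookupMCtx Θ x))
                      (sym (mrenCtx-mrenCtx (embᴹ (keep ι)) there (lookupMCtx Θ x)))) })
  (λ { (here refl) → trans (mrenTm-mrenTm there (embᴹ ι) T)
                           (sym (mrenTm-mrenTm (embᴹ (keep ι)) there T))
     ; (there x)   → trans (cong (mrenTm there) (types (embᴹ-MCtxRen ι) x))
                    (trans (mrenTm-mrenTm there (embᴹ ι) (lookupMTy Θ x))
                      (sym (mrenTm-mrenTm (embᴹ (keep ι)) there (lookupMTy Θ x)))) })
embᴹ-MCtxRen {Θ = Θ} (drop ι) = mctxRen
  (λ x → trans (cong (mrenCtx there) (ctxs (embᴹ-MCtxRen ι) x))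
               (mrenCtx-mrenCtx there (embᴹ ι) (lookupMCtx Θ x)))
  (λ x → trans (cong (mrenTm there) (types (embᴹ-MCtxRen ι) x))
               (mrenTm-mrenTm there (embᴹ ι) (lookupMTy Θ x)))

proposition3p7 : ∀ {Σ : Sig} (𝕋 : Theory Σ) →
    (∀ {θ : MScope} {γ δ : Scope} {Θ : MCtx Σ [] θ} {Γ : Ctx Σ θ 0 γ} {Δ : Ctx Σ θ 0 δ}
    {𝒥 : Judgement Σ θ γ} (ι : Γ ⊑ Δ) →
    𝕋 ∣ Θ ⨟ Γ ⊢ 𝒥 → 𝕋 ∣ Θ ⨟ Δ ⊢ ctx → 𝕋 ∣ Θ ⨟ Δ ⊢ ren𝒥 (emb ι) 𝒥)
    ×
    (∀ {θ ξ : MScope} {γ : Scope} {Θ : MCtx Σ [] θ} {Ξ : MCtx Σ [] ξ} {Γ : Ctx Σ θ 0 γ}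
    {𝒥 : Judgement Σ θ γ} (ι : Θ ⊑ᴹ Ξ) →
    𝕋 ∣ Θ ⨟ Γ ⊢ 𝒥 → 𝕋 ∣ Ξ ⊢ → 𝕋 ∣ Ξ ⨟ mrenCtx (embᴹ ι) Γ ⊢ mren𝒥 (embᴹ ι) 𝒥)
proposition3p7 𝕋 =
  (λ ι D c → weakens 𝕋 D (emb-CtxRen ι) c) ,
  (λ ι D c → mweakens 𝕋 (embᴹ-MCtxRen ι) c D)
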